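{- Let $k$ and $n$ be integers with $k\geq 2$ and $n\geq 4$. Let $G$ be an $n$-vertex graph such that there is a labelling $v_1,\ldots,v_n$ of $V(G)$ with the following two properties: (i) for every edge $v_iv_j\in E(G)$ we have $|i-j|\leq k$; (ii) for every $i\in[n]$, \[ \deg_G(v_i)\geq \min\{\,k+2,\ \min\{i-1,k\}+\min\{n-i,k\}\,\}. \] Then $G$ contains a Hamilton cycle.
   Context: For a graph $G$ on $n$ vertices, condition (i) says that the labelling is an embedding of $G$ into $P_n^k$, the $k$-th power of the path $v_1v_2\cdots v_n$ (in which $v_i,v_j$ are adjacent iff $1\le|i-j|\le k$); the number $\min\{i-1,k\}+\min\{n-i,k\}$ is the degree of the $i$-th vertex in $P_n^k$. The paper abbreviates the existence of such a labelling with the condition $\deg_G(v_i)\ge\min\{\ell,\deg_{P_n^k}(v_i)\}$ for all $i$ as $\delta^k_{\mathrm{eff}}(G)\geq \ell$ ("effective minimum degree at least $\ell$"); here $\ell=k+2$. -}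

module Defs where

open import Data.Nat using (ℕ; zero; suc; _∸_; _⊓_; _+_; _≤_; ∣_-_∣; _%_; _<_)
open import Data.Nat.DivMod using (m%n<n)
open import Data.Product using (Σ)
open import Data.Fin using (Fin; toℕ; fromℕ<)
open import Data.List using (length; filter; allFin)
open import Data.Fin.Permutation using (Permutation′; _⟨$⟩ʳ_)
open import Relation.Nullary using (Dec; ¬_)
open import Relation.Binary.PropositionalEquality using (_≡_)

record Graph (n : ℕ) : Set₁ where
  field
    Adj    : Fin n → Fin n → Set
    adj?   : (u v : Fin n) → Dec (Adj u v)
    sym    : ∀ {u v} → Adj u v → Adj v u
    irrefl : ∀ {u} → ¬ Adj u u
open Graph public

deg : ∀ {n} → Graph n → Fin n → ℕ
deg {n} G v = length (filter (adj? G v) (allFin n))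

-- degree of the (0-based) i-th vertex in the k-th power of the path on n vertices:
-- with 1-based index i+1 this is min{i,k} + min{n-(i+1),k}
pathPowDeg : (n k : ℕ) → Fin n → ℕ
pathPowDeg n k i = (toℕ i ⊓ k) + ((n ∸ suc (toℕ i)) ⊓ k)

next : ∀ {m} → Fin (suc m) → Fin (suc m)
next {m} i = fromℕ< (m%n<n (suc (toℕ i)) (suc m))

HamiltonCycle : ∀ {m} → Graph (suc m) → Set
HamiltonCycle {m} G =
  Σ (Permutation′ (suc m)) λ σ → ∀ i → Adj G (σ ⟨$⟩ʳ i) (σ ⟨$⟩ʳ next i)

{-# OPTIONS --safe #-}
-- A Bondy–Chvátal closure argument, made local by discarding vertices from the left.
-- Let E u be G together with all pairs of labels below u. If the clique on the labels
-- [l, w] makes [l, n) Hamiltonian, so does the clique on [l, w): rotate the cycle to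
-- w h … x with x < w not adjacent to w. For consecutive a, b on h … x with a < w and
-- b adjacent to w, the tour w h … a x … b is a cycle closed by a genuine edge. If there is
-- no such pair, all successors of clique vertices are non-neighbours of w lying in
-- [l, w + k], which forces deg w ≤ 1 + #((w, w + k] ∩ [0, n)), against the degree bound
-- if w ≥ 2; for w = 1 the degree bound already gives the edge {0, 1}. Doing this
-- at both neighbours of w removes every use of a clique edge at w.
-- On the other hand l can be inserted next to l + 1 as soon as the clique contains
-- [l, l + 1 + k]. So start with the last k + 1 labels (a clique), alternate insertion of
-- the next smaller label with the shrinking step down to l = 0, then shrink to the empty clique.

module Submission where

open import Defs
open import Data.Nat using (ℕ; suc; _+_; _≤_; _⊓_; ∣_-_∣)
open import Data.Fin using (Fin; toℕ)
open import Data.Fin.Permutation using (Permutation′; _⟨$⟩ʳ_)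
open import Data.Product using (Σ; _×_)
import Algebra.Properties.CommutativeMonoid.Sum
open import Data.Fin as Fin using (fromℕ<; cast)
open import Data.Fin.Permutation using (Permutation; _∘ₚ_; cast-id)
open import Data.Fin.Properties using (toℕ-cast; toℕ-fromℕ<; toℕ-injective; toℕ<n; any?)
open import Data.Nat using (zero; _∸_; _<_; _%_; z≤n; s≤s; s≤s⁻¹)
open import Data.Nat.DivMod using (m%n<n; m<n⇒m%n≡m; n%n≡0)
open import Data.Nat.Properties
open import Data.Nat.ListAction using (sum)
open import Data.Nat.ListAction.Properties using (sum-↭)
open import Data.Nat.Tactic.RingSolver using (solve-∀)
open import Data.List using (List; []; _∷_; _++_; map; iterate; lookup; length; filter; tabulate)
open import Data.List.Properties using (++-identityʳ; length-iterate)
open import Data.List.Membership.Propositional using (_∈_)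
open import Data.List.Membership.Propositional.Properties using (∈-∃++)
open import Data.List.Relation.Unary.All as All using (All; []; _∷_)
open import Data.List.Relation.Unary.Any using (here; there)
open import Data.List.Relation.Unary.AllPairs using ([]; _∷_)
open import Data.List.Relation.Unary.Unique.Propositional using (Unique)
open import Data.List.Relation.Binary.Permutation.Propositional
  using (_↭_; ↭-refl; ↭-sym; ↭-trans; ↭-prep; ↭-reflexive; ↭⇒↭ₛ)
import Data.List.Relation.Binary.Permutation.Propositional.Properties as ↭
import Data.List.Relation.Binary.Permutation.Setoid.Properties as ↭ₛ
import Data.List.Relation.Binary.Permutation.Homogeneous as ↭ₕ
open import Data.Product using (∃; _,_; proj₁; proj₂)
open import Data.Sum using (_⊎_; inj₁; inj₂)
import Data.Sum as Sum
open import Function using (_∘_; id)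
open import Relation.Binary using (Decidable; Symmetric; tri<; tri≈; tri>)
open import Relation.Binary.PropositionalEquality
  using (_≡_; _≢_; refl; trans; cong; subst; subst₂; setoid)
import Relation.Binary.PropositionalEquality as ≡
open import Relation.Nullary using (Dec; yes; no; ¬_; contradiction; _×-dec_)

module Fin∑ = Algebra.Properties.CommutativeMonoid.Sum +-0-commutativeMonoid

-- Indicators, and sums over intervals of labels.

𝟙 : {P : Set} → Dec P → ℕ
𝟙 (yes _) = 1
𝟙 (no _)  = 0

module _ {P : Set} where

  𝟙≤1 : (P? : Dec P) → 𝟙 P? ≤ 1
  𝟙≤1 (yes _) = ≤-refl
  𝟙≤1 (no _)  = z≤n

  𝟙-true : (P? : Dec P) → P → 𝟙 P? ≡ 1
  𝟙-true (yes _) p = refl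
  𝟙-true (no ¬p) p = contradiction p ¬p

  𝟙-false : (P? : Dec P) → ¬ P → 𝟙 P? ≡ 0
  𝟙-false (yes p) ¬p = contradiction p ¬p
  𝟙-false (no _)  ¬p = refl

𝟙-mono : {P Q : Set} (P? : Dec P) (Q? : Dec Q) → (P → Q) → 𝟙 P? ≤ 𝟙 Q?
𝟙-mono (yes p) Q? f = ≤-reflexive (≡.sym (𝟙-true Q? (f p)))
𝟙-mono (no _)  Q? f = z≤n

∑ : (ℕ → ℕ) → List ℕ → ℕ
∑ f xs = sum (map f xs)

∑-↭ : ∀ f {xs ys} → xs ↭ ys → ∑ f xs ≡ ∑ f ys
∑-↭ f p = sum-↭ (↭.map⁺ f p)

∑-mono : ∀ {f g} → (∀ x → f x ≤ g x) → ∀ xs → ∑ f xs ≤ ∑ g xs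
∑-mono f≤g []       = z≤n
∑-mono f≤g (x ∷ xs) = +-mono-≤ (f≤g x) (∑-mono f≤g xs)

range : ℕ → ℕ → List ℕ
range l d = iterate suc l d

range-≥ : ∀ l d → All (l ≤_) (range l d)
range-≥ l zero    = []
range-≥ l (suc d) = ≤-refl ∷ All.map <⇒≤ (range-≥ (suc l) d)

range-< : ∀ l d → All (_< l + d) (range l d)
range-< l zero    = []
range-< l (suc d) =
  m<m+n l (s≤s z≤n) ∷ subst (λ e → All (_< e) (range (suc l) d)) (≡.sym (+-suc l d)) (range-< (suc l) d)

range-unique : ∀ l d → Unique (range l d)
range-unique l zero    = []
range-unique l (suc d) = All.map <⇒≢ (range-≥ (suc l) d) ∷ range-unique (suc l) d

∈-range : ∀ {l d x} → l ≤ x → x < l + d → x ∈ range l d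
∈-range {l} {zero}  l≤x x<e = contradiction (subst (_ <_) (+-identityʳ l) x<e) (≤⇒≯ l≤x)
∈-range {l} {suc d} {x} l≤x x<e with m≤n⇒m<n∨m≡n l≤x
... | inj₁ l<x  = there (∈-range l<x (subst (x <_) (+-suc l d) x<e))
... | inj₂ refl = here refl

module _ {f : ℕ → ℕ} where

  -- Truncated subtraction covers a `c` past the end, where every term vanishes and the right-hand
  -- range is empty.
  ∑-range-skip : ∀ {c} l d → l ≤ c → (∀ x → x < c → f x ≡ 0) → ∑ f (range l d) ≡ ∑ f (range c (l + d ∸ c))
  ∑-range-skip {c} l zero    l≤c f≡0 rewrite +-identityʳ l | m≤n⇒m∸n≡0 l≤c = refl
  ∑-range-skip {c} l (suc d) l≤c f≡0 with m≤n⇒m<n∨m≡n l≤c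
  ... | inj₂ refl rewrite m+n∸m≡n l (suc d) = refl
  ... | inj₁ l<c rewrite f≡0 l l<c | +-suc l d = ∑-range-skip (suc l) d l<c f≡0

  module _ (f≤1 : ∀ x → f x ≤ 1) where

    ∑-range≤length : ∀ l d → ∑ f (range l d) ≤ d
    ∑-range≤length l zero    = z≤n
    ∑-range≤length l (suc d) = +-mono-≤ (f≤1 l) (∑-range≤length (suc l) d)

    ∑-range≤end : ∀ {e} l d → (∀ x → e ≤ x → f x ≡ 0) → ∑ f (range l d) ≤ e ∸ l
    ∑-range≤end     l zero    f≡0 = z≤n
    ∑-range≤end {e} l (suc d) f≡0 with <-≤-connex l e
    ... | inj₁ l<e = ≤-trans (+-mono-≤ (f≤1 l) (∑-range≤end (suc l) d f≡0))
                             (≤-reflexive (≡.sym (+-∸-assoc 1 l<e)))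
    ... | inj₂ e≤l rewrite f≡0 l e≤l = ≤-trans (∑-range≤end (suc l) d f≡0) (∸-monoʳ-≤ e (n≤1+n l))

-- Walks as lists, and their surgery.

-- Trail R P x xs: the list x ∷ xs is an R-chain whose last entry satisfies P.
data Trail (R : ℕ → ℕ → Set) (P : ℕ → Set) : ℕ → List ℕ → Set where
  end : ∀ {x} → P x → Trail R P x []
  _∷_ : ∀ {x y xs} → R x y → Trail R P y xs → Trail R P x (y ∷ xs)

Closed : (ℕ → ℕ → Set) → ℕ → List ℕ → Set
Closed R x xs = Trail R (λ y → R y x) x xs

module _ {R : ℕ → ℕ → Set} where

  trail-map-on : ∀ {R′ P P′} {Z : ℕ → Set} {x xs} → (∀ {y z} → Z y → Z z → R y z → R′ y z) → (∀ {y} → Z y → P y → P′ y) →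
              All Z (x ∷ xs) → Trail R P x xs → Trail R′ P′ x xs
  trail-map-on f g (z ∷ [])      (end p)  = end (g z p)
  trail-map-on f g (z ∷ z′ ∷ zs) (r ∷ tr) = f z z′ r ∷ trail-map-on f g (z′ ∷ zs) tr

  trail-map : ∀ {R′ P P′ x xs} → (∀ {y z} → R y z → R′ y z) → (∀ {y} → P y → P′ y) →
              Trail R P x xs → Trail R′ P′ x xs
  trail-map f g (end p)  = end (g p)
  trail-map f g (r ∷ tr) = f r ∷ trail-map f g tr

  trail-any : ∀ {P Q x xs} → Trail R (λ y → P y ⊎ Q y) x xs → Trail R P x xs ⊎ Trail R Q x xs
  trail-any (end p)  = Sum.map end end p
  trail-any (r ∷ tr) = Sum.map (r ∷_) (r ∷_) (trail-any tr)

  trail-++ : ∀ {P x xs y ys} → Trail R (λ z → R z y) x xs → Trail R P y ys → Trail R P x (xs ++ y ∷ ys)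
  trail-++ (end r)  u = r ∷ u
  trail-++ (r ∷ tr) u = r ∷ trail-++ tr u

  trail-split : ∀ {P x y ys} xs → Trail R P x (xs ++ y ∷ ys) → Trail R (λ z → R z y) x xs × Trail R P y ys
  trail-split []       (r ∷ tr) = end r , tr
  trail-split (_ ∷ xs) (r ∷ tr) = let t , u = trail-split xs tr in r ∷ t , u

  -- `ys` is an accumulator. Moving the entries of the first walk onto it one by one turns that walk
  -- round, so its old last entry, where `P` is known, becomes the head.
  trail-reverse : Symmetric R → ∀ {P Q y xs ys} → Trail R P y xs → Trail R Q y ys →
                  ∃ λ x → ∃ λ zs → P x × (x ∷ zs ↭ y ∷ xs ++ ys) × Trail R Q x zs
  trail-reverse s {y = y} {ys = ys} (end p) u = y , ys , p , ↭-refl , u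
  trail-reverse s {y = y} {xs = x′ ∷ xs} {ys} (r ∷ tr) u =
    let x , zs , p , perm , v = trail-reverse s tr (s r ∷ u)
    in  x , zs , p , ↭-trans perm (↭.shift y (x′ ∷ xs) ys) , v

  closed-rotate : ∀ {v x xs} → Closed R v xs → x ∈ v ∷ xs → ∃ λ ys → x ∷ ys ↭ v ∷ xs × Closed R x ys
  closed-rotate {xs = xs} c (here refl) = xs , ↭-refl , c
  closed-rotate {v} {x} c (there x∈xs) with ∈-∃++ x∈xs
  ... | as , bs , refl =
    let t , u = trail-split as c
    in  bs ++ v ∷ as , ↭.++-comm (x ∷ bs) (v ∷ as) , trail-++ u t

-- Partial closures of a graph on labels.

module Labelled
  (n k : ℕ) (2≤k : 2 ≤ k)
  (_~_ : ℕ → ℕ → Set) (_~?_ : Decidable _~_)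
  (~-sym : Symmetric _~_) (~-irrefl : ∀ {a} → ¬ (a ~ a))
  (~-near : ∀ {a b} → a ~ b → b ≤ a + k)
  (deg≥ : ∀ w → w < n → (k + 2) ⊓ (w ⊓ k + (n ∸ suc w) ⊓ k) ≤ ∑ (λ b → 𝟙 (w ~? b)) (range 0 n))
  where

  E : ℕ → ℕ → ℕ → Set
  E u a b = (a < u × b < u) ⊎ a ~ b

  E-sym : ∀ u → Symmetric (E u)
  E-sym u (inj₁ (p , q)) = inj₁ (q , p)
  E-sym u (inj₂ r)       = inj₂ (~-sym r)

  Ham : ℕ → ℕ → ℕ → Set
  Ham l d u = ∃ λ v → ∃ λ q → v ∷ q ↭ range l d × Closed (E u) v q

  -- Counting the neighbours of `w` along a walk.

  left right nbr : ℕ → ℕ → ℕ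
  left  w b = 𝟙 (b <? w)
  right w b = 𝟙 ((w <? b) ×-dec (b ≤? w + k))
  nbr   w b = 𝟙 (w ~? b)

  1≤left+right : ∀ {w b} → b ≢ w → b ≤ w + k → 1 ≤ left w b + right w b
  1≤left+right {w} {b} b≢w b≤w+k with <-cmp b w
  ... | tri< b<w _ _ = ≤-trans (≤-reflexive (≡.sym (𝟙-true (b <? w) b<w))) (m≤m+n _ _)
  ... | tri≈ _ b≡w _ = contradiction b≡w b≢w
  ... | tri> _ _ w<b =
    ≤-trans (≤-reflexive (≡.sym (𝟙-true ((w <? b) ×-dec (b ≤? w + k)) (w<b , b≤w+k)))) (m≤n+m _ _)

  nbr≤left+right : ∀ w {b} → nbr w b ≤ left w b + right w b
  nbr≤left+right w {b} with w ~? b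
  ... | no _  = z≤n
  ... | yes r = 1≤left+right (λ { refl → ~-irrefl r }) (~-near r)

  module _ {w : ℕ} where

    -- If `a < w`, then `b` is not adjacent to `w`, and no edge at `a` reaches beyond `w + k`, so
    -- `b` is counted on the right. Otherwise `left w a` vanishes, and a neighbour of `w` lies
    -- within `w + k`.
    nbr+left≤ : ∀ {a b} → E w a b → b ≢ w → ¬ (a < w × w ~ b) → nbr w b + left w a ≤ left w b + right w b
    nbr+left≤ {a} {b} e b≢w ¬ab with a <? w
    ... | no _ = ≤-trans (≤-reflexive (+-identityʳ (nbr w b))) (nbr≤left+right w)
    ... | yes a<w rewrite 𝟙-false (w ~? b) (λ r → ¬ab (a<w , r)) = 1≤left+right b≢w (b≤w+k e)
      where
      b≤w+k : E w a b → b ≤ w + k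
      b≤w+k (inj₁ (_ , b<w)) = ≤-trans (<⇒≤ b<w) (m≤m+n w k)
      b≤w+k (inj₂ r)         = ≤-trans (~-near r) (+-monoˡ-≤ k (<⇒≤ a<w))

    -- The inequality for consecutive entries telescopes in `left`; the last entry contributes the
    -- 1.
    reroute-or-count : ∀ {h t} → Trail (E w) (_< w) h t → All (_≢ w) t →
      (∃ λ t′ → t′ ↭ t × Trail (E w) (w ~_) h t′) ⊎ ∑ (nbr w) t + left w h ≤ 1 + ∑ (right w) t
    reroute-or-count {h} (end _) _ = inj₂ (𝟙≤1 (h <? w))
    reroute-or-count {h} (_∷_ {y = b} {xs = t} e tr) (b≢w ∷ t≢w) with (h <? w) ×-dec (w ~? b)
    ... | yes (h<w , w~b) =
      -- `h` and the last entry `x` are both below `w`, hence joined in `E w`; from `x` the rest is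
      -- walked backwards to `b`.
      let x , r , x<w , perm , u = trail-reverse (E-sym w) tr (end w~b)
      in  inj₁ (x ∷ r , ↭-trans perm (↭-reflexive (++-identityʳ (b ∷ t))) , inj₁ (h<w , x<w) ∷ u)
    ... | no ¬hb with reroute-or-count tr t≢w
    ...   | inj₁ (t′ , perm , u) = inj₁ (b ∷ t′ , ↭-prep b perm , e ∷ u)
    ...   | inj₂ count = inj₂ (begin
        nbr w b + ∑ (nbr w) t + left w h      ≡⟨ rearrange (nbr w b) (∑ (nbr w) t) (left w h) ⟩
        ∑ (nbr w) t + (nbr w b + left w h)    ≤⟨ +-monoʳ-≤ (∑ (nbr w) t) (nbr+left≤ e b≢w ¬hb) ⟩
        ∑ (nbr w) t + (left w b + right w b)  ≡⟨ +-assoc (∑ (nbr w) t) (left w b) (right w b) ⟨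
        ∑ (nbr w) t + left w b + right w b    ≤⟨ +-monoˡ-≤ (right w b) count ⟩
        1 + ∑ (right w) t + right w b         ≡⟨ cong suc (+-comm (∑ (right w) t) (right w b)) ⟩
        1 + (right w b + ∑ (right w) t)       ∎)
      where
      open ≤-Reasoning
      rearrange : ∀ x y z → x + y + z ≡ y + (x + z)
      rearrange = solve-∀

    right-irrefl : right w w ≡ 0
    right-irrefl = 𝟙-false ((w <? w) ×-dec (w ≤? w + k)) (λ p → <-irrefl refl (proj₁ p))

    nbr-irrefl : nbr w w ≡ 0
    nbr-irrefl = 𝟙-false (w ~? w) ~-irrefl

    -- The hypothesis on sums concerns the whole cycle `w ∷ h ∷ t`, so it depends only on the labels
    -- and can be checked on the interval, whatever their order.
    reroute : ∀ {h t} → Trail (E w) (λ x → x < w ⊎ w ~ x) h t → All (_≢ w) t →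
      ¬ (∑ (nbr w) (w ∷ h ∷ t) ≤ 1 + ∑ (right w) (w ∷ h ∷ t)) →
      ∃ λ t′ → t′ ↭ t × Trail (E w) (w ~_) h t′
    reroute {h} {t} tr t≢w many with trail-any tr
    ... | inj₂ tr′ = t , ↭-refl , tr′
    ... | inj₁ tr′ with reroute-or-count tr′ t≢w
    ...   | inj₁ r     = r
    ...   | inj₂ count = contradiction bound many
      where
      open ≤-Reasoning
      rearrange : ∀ x y z → x + y + z ≡ z + x + y
      rearrange = solve-∀
      bound : ∑ (nbr w) (w ∷ h ∷ t) ≤ 1 + ∑ (right w) (w ∷ h ∷ t)
      bound = begin
        ∑ (nbr w) (w ∷ h ∷ t)                 ≡⟨ cong (_+ ∑ (nbr w) (h ∷ t)) nbr-irrefl ⟩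
        -- `h` is missing from the sums over `t`; its `left w h` is just the term that `count`
        -- absorbs.
        nbr w h + ∑ (nbr w) t                 ≤⟨ +-monoˡ-≤ (∑ (nbr w) t) (nbr≤left+right w) ⟩
        left w h + right w h + ∑ (nbr w) t    ≡⟨ rearrange (left w h) (right w h) (∑ (nbr w) t) ⟩
        ∑ (nbr w) t + left w h + right w h    ≤⟨ +-monoˡ-≤ (right w h) count ⟩
        1 + ∑ (right w) t + right w h         ≡⟨ cong suc (+-comm (∑ (right w) t) (right w h)) ⟩
        1 + ∑ (right w) (h ∷ t)               ≡⟨ cong (λ z → 1 + (z + ∑ (right w) (h ∷ t))) right-irrefl ⟨
        1 + ∑ (right w) (w ∷ h ∷ t)           ∎

  ∑right≤ : ∀ w {l d} → l + d ≡ n → l ≤ w → ∑ (right w) (range l d) ≤ (n ∸ suc w) ⊓ k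
  ∑right≤ w {l} {d} refl l≤w = begin
    ∑ (right w) (range l d)                    ≡⟨ ∑-range-skip l d (m≤n⇒m≤1+n l≤w) below ⟩
    ∑ (right w) (range (suc w) (n ∸ suc w))    ≤⟨ ⊓-glb (∑-range≤length ≤1 (suc w) (n ∸ suc w)) ≤k ⟩
    (n ∸ suc w) ⊓ k                            ∎
    where
    open ≤-Reasoning
    ≤1 : ∀ x → right w x ≤ 1
    ≤1 x = 𝟙≤1 ((w <? x) ×-dec (x ≤? w + k))
    below : ∀ x → x < suc w → right w x ≡ 0
    below x x≤w = 𝟙-false ((w <? x) ×-dec (x ≤? w + k)) (λ p → <⇒≱ (proj₁ p) (s≤s⁻¹ x≤w))
    above : ∀ x → suc w + k ≤ x → right w x ≡ 0
    above x w+k<x = 𝟙-false ((w <? x) ×-dec (x ≤? w + k)) (λ p → <⇒≱ w+k<x (proj₂ p))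
    ≤k : ∑ (right w) (range (suc w) (n ∸ suc w)) ≤ k
    ≤k = ≤-trans (∑-range≤end ≤1 (suc w) (n ∸ suc w) above) (≤-reflexive (m+n∸m≡n (suc w) k))

  -- Dropping the labels below `l` costs `w` no neighbours, so its full degree bound still applies
  -- on the shorter interval.
  ∑nbr≡ : ∀ w {l d} → l + d ≡ n → (∀ x → x < l → ¬ (w ~ x)) → ∑ (nbr w) (range l d) ≡ ∑ (nbr w) (range 0 n)
  ∑nbr≡ w {l} {d} refl far = ≡.sym (trans
    (∑-range-skip 0 n z≤n (λ x x<l → 𝟙-false (w ~? x) (far x x<l)))
    (cong (λ e → ∑ (nbr w) (range l e)) (m+n∸m≡n l d)))

  -- With `r` as below, both arguments of the outer minimum are at least `r + 2`: `k + 2` since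
  -- `r ≤ k`, the other since `w` and `k` are at least 2. Hence the degree exceeds `1 + r`.
  many-nbrs : ∀ {w l d} → 2 ≤ w → w < n → l + d ≡ n → l ≤ w → (∀ x → x < l → ¬ (w ~ x)) →
              ¬ (∑ (nbr w) (range l d) ≤ 1 + ∑ (right w) (range l d))
  many-nbrs {w} {l} {d} 2≤w w<n l+d≡n l≤w far few = <-irrefl refl (begin-strict
    1 + r                            <⟨ ⊓-glb 1+r<k+2 1+r<pathDeg ⟩
    (k + 2) ⊓ (w ⊓ k + r)            ≤⟨ deg≥ w w<n ⟩
    ∑ (nbr w) (range 0 n)            ≡⟨ ∑nbr≡ w l+d≡n far ⟨
    ∑ (nbr w) (range l d)            ≤⟨ few ⟩
    1 + ∑ (right w) (range l d)      ≤⟨ s≤s (∑right≤ w l+d≡n l≤w) ⟩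
    1 + r                            ∎)
    where
    open ≤-Reasoning
    r : ℕ
    r = (n ∸ suc w) ⊓ k
    1+r<k+2 : 2 + r ≤ k + 2
    1+r<k+2 = ≤-trans (s≤s (s≤s (m⊓n≤n (n ∸ suc w) k))) (≤-reflexive (+-comm 2 k))
    1+r<pathDeg : 2 + r ≤ w ⊓ k + r
    1+r<pathDeg = +-monoˡ-≤ r (⊓-glb 2≤w 2≤k)

  -- Without this edge all neighbours of 1 lie to its right, so there are at most `r`, one fewer
  -- than the degree bound demands.
  1~0 : 1 < n → 1 ~ 0
  1~0 1<n with 1 ~? 0
  ... | yes r = r
  ... | no ¬r = contradiction (begin-strict
    r                                <⟨ ⊓-glb 1+r≤k+2 (+-monoˡ-≤ r (⊓-glb {1} ≤-refl (<⇒≤ 2≤k))) ⟩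
    (k + 2) ⊓ (1 ⊓ k + r)            ≤⟨ deg≥ 1 1<n ⟩
    ∑ (nbr 1) (range 0 n)            ≤⟨ ∑-mono nbr≤right (range 0 n) ⟩
    ∑ (right 1) (range 0 n)          ≤⟨ ∑right≤ 1 refl z≤n ⟩
    r                                ∎) (<-irrefl refl)
    where
    open ≤-Reasoning
    r : ℕ
    r = (n ∸ 2) ⊓ k
    1+r≤k+2 : suc r ≤ k + 2
    1+r≤k+2 = ≤-trans (s≤s (m⊓n≤n (n ∸ 2) k)) (≤-trans (n≤1+n (suc k)) (≤-reflexive (+-comm 2 k)))
    nbr≤right : ∀ b → nbr 1 b ≤ right 1 b
    nbr≤right zero    = ≤-trans (≤-reflexive (𝟙-false (1 ~? 0) ¬r)) z≤n
    nbr≤right (suc b) = nbr≤left+right 1 {suc b}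

  -- Shrinking the clique and inserting a label.

  shrink-clique : ∀ {l d w} → 1 < d → l + d ≡ n → l ≤ w → w < n → (∀ x → x < l → ¬ (w ~ x)) →
                  Ham l d (suc w) → Ham l d w
  shrink-clique {l} {d} {w} 1<d refl l≤w w<n far (v , q , perm , c)
    with closed-rotate c (↭.∈-resp-↭ (↭-sym perm) (∈-range l≤w w<n))
  ... | [] , perm′ , _ =
    contradiction (trans (↭.↭-length (↭-trans perm′ perm)) (length-iterate suc l d)) (<⇒≢ 1<d)
  ... | h ∷ t , perm′ , e ∷ tr =
    -- The first pass makes the last entry adjacent to `w` and keeps `h` as head.
    let t₁ , perm₁ , tr₁ = reroute′ perm₀ (trail-map-on old-edge old-end (h≢w ∷ t≢w) tr) t≢w
        -- Reversing puts that last entry `x` first and `h` last, so the second pass repairs the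
        -- other end while `w~x` is kept.
        x , r , w~x , perm₂ , tr₂ =
          trail-reverse (E-sym w) tr₁ (end (old-end h≢w (E-sym (suc w) e)))
        perm₃ = ↭-trans perm₂ (↭-trans (↭-reflexive (++-identityʳ (h ∷ t₁))) (↭-prep h perm₁))
        perm₄ = ↭-trans (↭-prep w perm₃) perm₀
        r₁ , perm₅ , tr₃ = reroute′ perm₄ tr₂ (All.tail (≢w perm₄))
    in  w , x ∷ r₁ , ↭-trans (↭-prep w (↭-prep x perm₅)) perm₄ ,
        inj₂ w~x ∷ trail-map id (inj₂ ∘ ~-sym) tr₃
    where
    perm₀ : w ∷ h ∷ t ↭ range l d
    perm₀ = ↭-trans perm′ perm
    ≢w : ∀ {xs} → w ∷ xs ↭ range l d → All (_≢ w) xs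
    ≢w p with w≢ ∷ _ ← ↭ₛ.Unique-resp-↭ (setoid ℕ) (↭⇒↭ₛ (↭-sym p)) (range-unique l d) =
      All.map (_∘ ≡.sym) w≢
    h≢w : h ≢ w
    h≢w = All.head (≢w perm₀)
    t≢w : All (_≢ w) t
    t≢w = All.tail (≢w perm₀)
    old-edge : ∀ {a b} → a ≢ w → b ≢ w → E (suc w) a b → E w a b
    old-edge a≢w b≢w (inj₁ (a≤w , b≤w)) = inj₁ (≤∧≢⇒< (s≤s⁻¹ a≤w) a≢w , ≤∧≢⇒< (s≤s⁻¹ b≤w) b≢w)
    old-edge _   _   (inj₂ r)           = inj₂ r
    old-end : ∀ {a} → a ≢ w → E (suc w) a w → a < w ⊎ w ~ a
    old-end a≢w (inj₁ (a≤w , _)) = inj₁ (≤∧≢⇒< (s≤s⁻¹ a≤w) a≢w)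
    old-end _   (inj₂ r)         = inj₂ (~-sym r)
    reroute′ : ∀ {h t} → w ∷ h ∷ t ↭ range l d → Trail (E w) (λ x → x < w ⊎ w ~ x) h t → All (_≢ w) t →
               ∃ λ t′ → t′ ↭ t × Trail (E w) (w ~_) h t′
    reroute′ {t = t} p tr t≢w with 2 ≤? w
    ... | yes 2≤w = reroute tr t≢w λ few → many-nbrs 2≤w w<n refl l≤w far
                      (subst₂ (λ a b → a ≤ 1 + b) (∑-↭ (nbr w) p) (∑-↭ (right w) p) few)
    ... | no w<2 = t , ↭-refl , trail-map id low tr
      where
      low : ∀ {a} → a < w ⊎ w ~ a → w ~ a
      low (inj₂ r) = r
      -- Only `w = 1` and `a = 0` are possible here.
      low (inj₁ a<w) with refl ← ≤-antisym (s≤s⁻¹ (≰⇒> w<2)) (≤-trans (s≤s z≤n) a<w)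
        with refl ← n<1⇒n≡0 a<w = 1~0 w<n

  -- `l` goes just before `suc l`. The predecessor `y` of `suc l` is either below `u` already or
  -- adjacent to `suc l`, and then `y ≤ suc l + k < u`; so `y` and `l` are joined in the clique.
  insert-least : ∀ {l d u} → 0 < d → suc l + k < u → Ham (suc l) d u → Ham l (suc d) u
  insert-least {l} {d} {u} 0<d l+k<u (v , q , perm , c)
    with ys , perm′ , c′ ← closed-rotate c (↭.∈-resp-↭ (↭-sym perm) (∈-range ≤-refl (m<m+n (suc l) 0<d))) =
    l , suc l ∷ ys , ↭-prep l (↭-trans perm′ perm) , inj₁ (<⇒≤ l+1<u , l+1<u) ∷ trail-map id close c′
    where
    l+1<u : suc l < u
    l+1<u = ≤-<-trans (m≤m+n (suc l) k) l+k<u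
    close : ∀ {y} → E u y (suc l) → E u y l
    close (inj₁ (y<u , _)) = inj₁ (y<u , <⇒≤ l+1<u)
    close (inj₂ r)         = inj₁ (≤-<-trans (~-near (~-sym r)) l+k<u , <⇒≤ l+1<u)

  -- Running the induction.

  complete-ham : ∀ l d → l + d ≡ n → 0 < d → Ham l d n
  complete-ham l (suc d) refl _ = l , range (suc l) d , ↭-refl , trail (range-< l (suc d))
    where
    trail : ∀ {x xs} → All (_< n) (x ∷ xs) → Trail (E n) (λ y → E n y l) x xs
    trail (x<n ∷ [])       = end (inj₁ (x<n , m<m+n l (s≤s z≤n)))
    trail (x<n ∷ y<n ∷ ys) = inj₁ (x<n , y<n) ∷ trail (y<n ∷ ys)

  -- The threshold makes the induction close: for `suc l` it exceeds `suc l + k`, as inserting `l`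
  -- requires, and one shrinking step then restores the form.
  ham-from : ∀ l d → l + d ≡ n → l + k < n → Ham l d (suc (l + k))
  ham-from l zero    refl l+k<n = contradiction l+k<n (≤⇒≯ (+-monoʳ-≤ l z≤n))
  ham-from l (suc d) l+d≡n l+k<n with m≤n⇒m<n∨m≡n l+k<n
  -- The interval has exactly `k + 1` labels here, all in the clique.
  ... | inj₂ eq = subst (Ham l (suc d)) (≡.sym eq) (complete-ham l (suc d) l+d≡n (s≤s z≤n))
  ... | inj₁ lt = shrink-clique (s≤s 0<d) l+d≡n (m≤n⇒m≤1+n (m≤m+n l k)) lt far
                    (insert-least 0<d ≤-refl (ham-from (suc l) d l+d≡n′ lt))
    where
    l+d≡n′ : suc l + d ≡ n
    l+d≡n′ = trans (≡.sym (+-suc l d)) l+d≡n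
    0<d : 0 < d
    0<d = ≤-trans (s≤s z≤n) (≤-trans 2≤k (+-cancelˡ-≤ (suc l) k d (≤-trans (<⇒≤ lt) (≤-reflexive (≡.sym l+d≡n′)))))
    far : ∀ x → x < l → ¬ (suc (l + k) ~ x)
    far x x<l r = <⇒≱ (m≤n⇒m≤1+n (+-monoˡ-≤ k x<l)) (~-near (~-sym r))

  ham-down : 1 < n → ∀ u → u ≤ n → Ham 0 n u → Ham 0 n 0
  ham-down 1<n zero    u≤n ham = ham
  ham-down 1<n (suc w) w<n ham =
    ham-down 1<n w (<⇒≤ w<n) (shrink-clique 1<n refl z≤n w<n (λ _ ()) ham)

  hamiltonian : 1 < n → ∃ λ v → ∃ λ q → v ∷ q ↭ range 0 n × Closed _~_ v q
  hamiltonian 1<n =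
    let v , q , perm , c = ham in v , q , perm , trail-map E₀ E₀ c
    where
    E₀ : ∀ {a b} → E 0 a b → a ~ b
    E₀ (inj₂ r) = r
    ham : Ham 0 n 0
    ham with <-≤-connex k n
    ... | inj₁ k<n = ham-down 1<n (suc k) k<n (ham-from 0 n refl k<n)
    -- When `n ≤ k` all labels start in the clique, and only shrinking remains.
    ... | inj₂ _   = ham-down 1<n n ≤-refl (complete-ham 0 n refl (<⇒≤ 1<n))

-- From cyclic lists of labels to permutations.

lookup-range : ∀ l d i → lookup (range l d) i ≡ l + toℕ i
lookup-range l (suc d) Fin.zero    = ≡.sym (+-identityʳ l)
lookup-range l (suc d) (Fin.suc i) = trans (lookup-range (suc l) d i) (≡.sym (+-suc l (toℕ i)))

-- With the head of a cycle as default `b`, the index just past the end returns to the start, and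
-- the closing edge is a consecutive pair like the others.
nth : ℕ → List ℕ → ℕ → ℕ
nth b []       i       = b
nth b (x ∷ xs) zero    = x
nth b (x ∷ xs) (suc i) = nth b xs i

lookup-nth : ∀ b xs i → lookup xs i ≡ nth b xs (toℕ i)
lookup-nth b (x ∷ xs) Fin.zero    = refl
lookup-nth b (x ∷ xs) (Fin.suc i) = lookup-nth b xs i

nth-length : ∀ b xs → nth b xs (length xs) ≡ b
nth-length b []       = refl
nth-length b (x ∷ xs) = nth-length b xs

trail-nth : ∀ {R b x xs} → Trail R (λ y → R y b) x xs →
            ∀ i → i < length (x ∷ xs) → R (nth b (x ∷ xs) i) (nth b (x ∷ xs) (suc i))
trail-nth (end r)  zero    _         = r
trail-nth (end r)  (suc i) (s≤s ())
trail-nth (r ∷ tr) zero    _         = r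
trail-nth (r ∷ tr) (suc i) (s≤s i<e) = trail-nth tr i i<e

-- Only `i = m` wraps round; there the remainder is 0, and position 0 and the default agree on `x`.
nth-% : ∀ {x xs m} → length xs ≡ m → ∀ i → i < suc m → nth x (x ∷ xs) (suc i % suc m) ≡ nth x (x ∷ xs) (suc i)
nth-% {x} {xs} {m} refl i (s≤s i≤m) with m≤n⇒m<n∨m≡n i≤m
... | inj₁ i<m rewrite m<n⇒m%n≡m (s≤s i<m) = refl
... | inj₂ refl = trans (cong (nth x (x ∷ xs)) (n%n≡0 (suc m))) (≡.sym (nth-length x xs))

-- Looking up in `range 0 m` returns the index itself, so matching positions of `xs` with positions
-- of the range yields the labels.
range-↭⇒permutation : ∀ {m xs} → xs ↭ range 0 m →
  Σ (Permutation′ m) λ π → ∀ b i → toℕ (π ⟨$⟩ʳ i) ≡ nth b xs (toℕ i)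
range-↭⇒permutation {m} {xs} p = (cast-id (≡.sym xs-length) ∘ₚ ρ ∘ₚ cast-id r-length) , correct
  where
  open ≡.≡-Reasoning
  r-length : length (range 0 m) ≡ m
  r-length = length-iterate suc 0 m
  xs-length : length xs ≡ m
  xs-length = trans (↭.↭-length p) r-length
  ρ : Permutation (length xs) (length (range 0 m))
  ρ = ↭ₕ.onIndices (↭⇒↭ₛ p)
  correct : ∀ b i → _
  correct b i = begin
    toℕ (cast r-length (ρ ⟨$⟩ʳ j))         ≡⟨ toℕ-cast r-length (ρ ⟨$⟩ʳ j) ⟩
    toℕ (ρ ⟨$⟩ʳ j)                         ≡⟨ lookup-range 0 m (ρ ⟨$⟩ʳ j) ⟨
    lookup (range 0 m) (ρ ⟨$⟩ʳ j)          ≡⟨ ↭ₛ.onIndices-lookup (setoid ℕ) (↭⇒↭ₛ p) j ⟨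
    lookup xs j                            ≡⟨ lookup-nth b xs j ⟩
    nth b xs (toℕ j)                       ≡⟨ cong (nth b xs) (toℕ-cast (≡.sym xs-length) i) ⟩
    nth b xs (toℕ i)                       ∎
    where
    j : Fin (length xs)
    j = cast (≡.sym xs-length) i

-- Degrees as sums over labels, and transfer to `Graph`.

length-filter-tabulate : ∀ {n} {A : Set} {P : A → Set} (P? : ∀ x → Dec (P x)) (f : Fin n → A) →
                         length (filter P? (tabulate f)) ≡ Fin∑.sum (λ i → 𝟙 (P? (f i)))
length-filter-tabulate {zero}  P? f = refl
length-filter-tabulate {suc n} P? f with P? (f Fin.zero)
... | yes _ = cong suc (length-filter-tabulate P? (f ∘ Fin.suc))
... | no _  = length-filter-tabulate P? (f ∘ Fin.suc)

sum≤∑-range : ∀ {n} (g : Fin n → ℕ) f l → (∀ i → g i ≤ f (l + toℕ i)) → Fin∑.sum g ≤ ∑ f (range l n)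
sum≤∑-range {zero}  g f l g≤f = z≤n
sum≤∑-range {suc n} g f l g≤f = +-mono-≤
  (subst (λ x → g Fin.zero ≤ f x) (+-identityʳ l) (g≤f Fin.zero))
  (sum≤∑-range (g ∘ Fin.suc) f (suc l) (λ i → subst (λ x → g (Fin.suc i) ≤ f x) (+-suc l (toℕ i)) (g≤f (Fin.suc i))))

theorem2 : (k m : ℕ) → 2 ≤ k → 4 ≤ suc m → (G : Graph (suc m))
    → Σ (Permutation′ (suc m)) (λ ℓ →
    (∀ i j → Adj G (ℓ ⟨$⟩ʳ i) (ℓ ⟨$⟩ʳ j) → ∣ toℕ i - toℕ j ∣ ≤ k)
    × (∀ i → (k + 2) ⊓ pathPowDeg (suc m) k i ≤ deg G (ℓ ⟨$⟩ʳ i)))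
    → HamiltonCycle G
theorem2 k m 2≤k 4≤n G (ℓ , near , deg≥) =
  let v , q , perm , c = hamiltonian (≤-trans (s≤s (s≤s z≤n)) 4≤n)
      π , π-nth = range-↭⇒permutation perm
      len : length q ≡ m
      len = suc-injective (trans (↭.↭-length perm) (length-iterate suc 0 (suc m)))
  -- `π` takes positions on the cycle to labels, `ℓ` takes labels to vertices.
  in  π ∘ₚ ℓ , λ i → ~⇒Adj (subst₂ _~_
        (≡.sym (π-nth v i))
        (≡.sym (trans (π-nth v (next i)) (trans (cong (nth v (v ∷ q)) (toℕ-fromℕ< (m%n<n (suc (toℕ i)) (suc m))))
                                               (nth-% len (toℕ i) (toℕ<n i)))))
        (trail-nth c (toℕ i) (subst (toℕ i <_) (cong suc (≡.sym len)) (toℕ<n i))))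
  where
  _~_ : ℕ → ℕ → Set
  -- Numbers that are not labels get no neighbours.
  a ~ b = ∃ λ i → ∃ λ j → toℕ i ≡ a × toℕ j ≡ b × Adj G (ℓ ⟨$⟩ʳ i) (ℓ ⟨$⟩ʳ j)
  _~?_ : Decidable _~_
  a ~? b = any? λ i → any? λ j → (toℕ i ≟ a) ×-dec (toℕ j ≟ b) ×-dec adj? G (ℓ ⟨$⟩ʳ i) (ℓ ⟨$⟩ʳ j)
  ~⇒Adj : ∀ {i j} → toℕ i ~ toℕ j → Adj G (ℓ ⟨$⟩ʳ i) (ℓ ⟨$⟩ʳ j)
  ~⇒Adj (i′ , j′ , i≡ , j≡ , e) with refl ← toℕ-injective i≡ | refl ← toℕ-injective j≡ = e
  ~-sym : Symmetric _~_
  ~-sym (i , j , i≡ , j≡ , e) = j , i , j≡ , i≡ , sym G e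
  ~-irrefl : ∀ {a} → ¬ (a ~ a)
  ~-irrefl (i , j , refl , j≡i , e) with refl ← toℕ-injective j≡i = irrefl G e
  ~-near : ∀ {a b} → a ~ b → b ≤ a + k
  ~-near (i , j , refl , refl , e) =
    ≤-trans (m≤n+∣n-m∣ (toℕ j) (toℕ i)) (+-monoʳ-≤ (toℕ i) (near i j e))
  deg≤ : ∀ i → deg G (ℓ ⟨$⟩ʳ i) ≤ ∑ (λ b → 𝟙 (toℕ i ~? b)) (range 0 (suc m))
  deg≤ i = begin
    deg G (ℓ ⟨$⟩ʳ i)                                         ≡⟨ length-filter-tabulate (adj? G (ℓ ⟨$⟩ʳ i)) id ⟩
    -- Reindexing by `ℓ` turns a count over vertices into one over labels.
    Fin∑.sum (λ u → 𝟙 (adj? G (ℓ ⟨$⟩ʳ i) u))                 ≡⟨ Fin∑.sum-permute (𝟙 ∘ adj? G (ℓ ⟨$⟩ʳ i)) ℓ ⟩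
    Fin∑.sum (λ j → 𝟙 (adj? G (ℓ ⟨$⟩ʳ i) (ℓ ⟨$⟩ʳ j)))        ≤⟨ sum≤∑-range _ _ 0 pointwise ⟩
    ∑ (λ b → 𝟙 (toℕ i ~? b)) (range 0 (suc m))               ∎
    where
    open ≤-Reasoning
    pointwise : ∀ j → 𝟙 (adj? G (ℓ ⟨$⟩ʳ i) (ℓ ⟨$⟩ʳ j)) ≤ 𝟙 (toℕ i ~? toℕ j)
    pointwise j = 𝟙-mono (adj? G (ℓ ⟨$⟩ʳ i) (ℓ ⟨$⟩ʳ j)) (toℕ i ~? toℕ j) (λ e → i , j , refl , refl , e)
  deg≥′ : ∀ w → w < suc m → (k + 2) ⊓ (w ⊓ k + (m ∸ w) ⊓ k) ≤ ∑ (λ b → 𝟙 (w ~? b)) (range 0 (suc m))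
  deg≥′ w w<n = subst (λ w → (k + 2) ⊓ (w ⊓ k + (m ∸ w) ⊓ k) ≤ ∑ (λ b → 𝟙 (w ~? b)) (range 0 (suc m)))
    (toℕ-fromℕ< w<n) (≤-trans (deg≥ (fromℕ< w<n)) (deg≤ (fromℕ< w<n)))
  open Labelled (suc m) k 2≤k _~_ _~?_ ~-sym ~-irrefl ~-near deg≥′ using (hamiltonian)
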